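{- Let $n$ be even. If $\mathcal{F}\subseteq 2^{[n]}$ is such that every component of $G_\mathcal{F}$ has at most $4$ vertices, then \[ |\mathcal{F}|\le 4\binom{n-2}{n/2-1}. \]
   Context: For $\mathcal{F}\subseteq 2^{[n]}$, $G_\mathcal{F}$ is the graph on $\mathcal{F}$ with distinct $A,B$ adjacent iff $A\subseteq B$ or $B\subseteq A$. -}

module Defs where

open import Data.Nat using (ℕ; _≤_)
open import Data.Fin.Subset using (Subset; _⊆_)
open import Data.List using (List; length)
open import Data.List.Membership.Propositional using (_∈_)
open import Data.List.Relation.Unary.All using (All)
open import Data.Product using (_×_)
open import Data.Sum using (_⊎_)
open import Relation.Binary.PropositionalEquality using (_≡_; _≢_)

-- A family F ⊆ 2^[n] is represented by a duplicate-free list of subsets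
-- (Subset n = Vec Bool n) of Fin n.

Adj : ∀ {n} → Subset n → Subset n → Set
Adj A B = A ≢ B × (A ⊆ B ⊎ B ⊆ A)

data Connected {n : ℕ} (F : List (Subset n)) : Subset n → Subset n → Set where
  here : ∀ {A} → A ∈ F → Connected F A A
  step : ∀ {A B C} → A ∈ F → Adj A B → Connected F B C → Connected F A C

open import Data.List.Relation.Unary.Unique.Propositional using (Unique)

ComponentsAtMost : ∀ {n} → ℕ → List (Subset n) → Set
ComponentsAtMost {n} k F =
  ∀ (A : Subset n) → A ∈ F →
  ∀ (C : List (Subset n)) → Unique C → All (Connected F A) C → length C ≤ k

{-# OPTIONS --safe #-}
module Submission where

open import Defs
open import Data.Bool as Bool using (Bool; true; false; T; _∧_; _∨_)
open import Data.Bool.ListAction using (any)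
open import Data.Bool.Properties using (T-∧; T-≡; ∧-comm)
open import Data.Empty using (⊥-elim)
open import Data.Fin.Subset using (Subset; _⊆_; ∣_∣)
open import Data.Fin.Subset.Properties
  using (drop-∷-⊆; out⊆; in⊆in; ∣p∣≤n; p⊆q⇒∣p∣≤∣q∣; _⊆?_)
open import Data.List using (List; []; _∷_; _++_; length; map)
open import Data.List.Membership.Propositional using (_∈_; lose; find)
open import Data.List.Membership.Propositional.Properties
  using (∈-∃++; ∈-++⁺ˡ; ∈-++⁺ʳ)
open import Data.List.Properties using (length-++)
open import Data.List.Relation.Binary.Permutation.Propositional
  using (_↭_; ↭-refl; ↭-trans; ↭-sym; prep; swap; ↭⇒↭ₛ)
open import Data.List.Relation.Binary.Permutation.Propositional.Properties
  using (All-resp-↭; ∈-resp-↭; ↭-length; shift; ++⁺ˡ)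
import Data.List.Relation.Binary.Permutation.Setoid.Properties as Setoid↭
open import Data.List.Relation.Unary.All as All using (All; []; _∷_)
open import Data.List.Relation.Unary.All.Properties using ()
  renaming (++⁺ to All-++⁺; ++⁻ˡ to All-++⁻ˡ)
open import Data.List.Relation.Unary.AllPairs as AllPairs using (AllPairs; []; _∷_)
open import Data.List.Relation.Unary.Any as Any using (here; there)
open import Data.List.Relation.Unary.Any.Properties using (any⁺; any⁻)
open import Data.List.Relation.Unary.Unique.Propositional using (Unique)
open import Data.Nat
open import Data.Nat.Combinatorics using (_C_; nCk≡n!/k![n-k]!; [n∸k]!k!∣n!)
open import Data.Nat.Divisibility using (_∣_; divides)
open import Data.Nat.DivMod using (m/n*n≡m; m*n/n≡m)
open import Data.Nat.ListAction using (sum)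
open import Data.Nat.Properties
open import Data.Nat.Tactic.RingSolver using (solve-∀)
open import Data.Product using (_×_; _,_; proj₁; proj₂; ∃; ∃₂)
open import Data.Sum as Sum using (_⊎_; inj₁; inj₂; [_,_]′)
open import Data.Unit using (⊤; tt)
open import Data.Vec as Vec using ([]; _∷_)
open import Data.Vec.Properties using (≡-dec)
open import Function using (_∘_; id)
open import Function.Bundles using (Equivalence)
open import Relation.Nullary
  using (¬_; Dec; yes; no; contradiction; ¬?; _×-dec_; _⊎-dec_)
open import Relation.Binary.PropositionalEquality

-- Let n = 2k. Distinct components of G_F meet disjoint sets of maximal chains
-- of 2^[n], so it is enough that any P with |P| ≤ 4 meets at least
-- |P| (2k−1) k! (k−1)! / 2 of the n! maximal chains. Remove from P a set A
-- farthest from the middle level, at size k ± d: it lies on (k+d)! (k−d)!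
-- chains (all n! of them if d = k), and otherwise each other B ∈ P takes away at
-- most the fraction 1/(k+d) of these. If d ≥ 2, this leaves at least k! k! new
-- chains. If d ≤ 1 throughout, count in units of k! (k−1)!: sets at level k lie
-- on k units, sets at levels k ± 1 on k+1, and each comparable pair costs at most
-- one unit. With q sets at levels k ± 1 and j at level k the count suffices when
-- at most (3q + j)/2 pairs cost something. Charging every pair that has a set off
-- the middle level is too much only for (q, j) = (3, 1) and (2, 2). In the first
-- case two of the sets off the middle share a level; in the second, one of the
-- charged pairs is incomparable or P is a diamond, where chains through bottom
-- and top also pass through the middle.

-- Indicators and finite sums.

𝟙 : Bool → ℕ
𝟙 false = 0
𝟙 true  = 1

𝟙-∧ : ∀ a b → 𝟙 (a ∧ b) ≡ 𝟙 a * 𝟙 b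
𝟙-∧ false b = refl
𝟙-∧ true  b = sym (+-identityʳ (𝟙 b))

𝟙-mono : ∀ {a b} → (T a → T b) → 𝟙 a ≤ 𝟙 b
𝟙-mono {false}         _ = z≤n
𝟙-mono {true}  {true}  _ = ≤-refl
𝟙-mono {true}  {false} f = ⊥-elim (f tt)

∧-T : ∀ {a b} → T (a ∧ b) → T a × T b
∧-T = Equivalence.to T-∧

sum< : ℕ → (ℕ → ℕ) → ℕ
sum< zero    f = 0
sum< (suc m) f = f 0 + sum< m (f ∘ suc)

sum<-mono : ∀ m {f g} → (∀ i → f i ≤ g i) → sum< m f ≤ sum< m g
sum<-mono zero    h = z≤n
sum<-mono (suc m) h = +-mono-≤ (h 0) (sum<-mono m (h ∘ suc))

sum<-cong : ∀ m {f g} → (∀ i → f i ≡ g i) → sum< m f ≡ sum< m g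
sum<-cong zero    h = refl
sum<-cong (suc m) h = cong₂ _+_ (h 0) (sum<-cong m (h ∘ suc))

sum<-+ : ∀ m f g → sum< m (λ i → f i + g i) ≡ sum< m f + sum< m g
sum<-+ zero    f g = refl
sum<-+ (suc m) f g = trans (cong (f 0 + g 0 +_) (sum<-+ m (f ∘ suc) (g ∘ suc)))
  (lemma (f 0) (g 0) (sum< m (f ∘ suc)) (sum< m (g ∘ suc)))
  where
  lemma : ∀ a b x d → a + b + (x + d) ≡ a + x + (b + d)
  lemma = solve-∀

sum<-* : ∀ m a f → sum< m (λ i → a * f i) ≡ a * sum< m f
sum<-* zero    a f = sym (*-zeroʳ a)
sum<-* (suc m) a f = trans (cong (a * f 0 +_) (sum<-* m a (f ∘ suc)))
  (sym (*-distribˡ-+ a (f 0) _))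

sum<-1 : ∀ m → sum< m (λ _ → 1) ≡ m
sum<-1 zero    = refl
sum<-1 (suc m) = cong suc (sum<-1 m)

sum<-0 : ∀ m → sum< m (λ _ → 0) ≡ 0
sum<-0 zero    = refl
sum<-0 (suc m) = sum<-0 m

-- The test `a <ᵇ suc i` means a ≤ i; in this form, lowering a and i together by one leaves it
-- unchanged by computation, so the recursive call has exactly the required type.
count-≥ : ∀ a m → sum< m (λ i → 𝟙 (a <ᵇ suc i)) ≡ m ∸ a
count-≥ zero    m       = sum<-1 m
count-≥ (suc a) zero    = refl
count-≥ (suc a) (suc m) = count-≥ a m

count-≤ : ∀ a m → sum< m (λ i → 𝟙 (i <ᵇ suc a)) ≡ suc a ⊓ m
count-≤ a       zero    = refl
count-≤ zero    (suc m) = cong suc (sum<-0 m)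
count-≤ (suc a) (suc m) = cong suc (count-≤ a m)

count-between : ∀ {a b} m → a ≤ b →
  sum< m (λ i → 𝟙 ((a <ᵇ suc i) ∧ (i <ᵇ suc b))) ≤ suc (b ∸ a)
count-between {b = b} m z≤n = ≤-trans (≤-reflexive (count-≤ b m)) (m⊓n≤m (suc b) m)
count-between zero    (s≤s p) = z≤n
count-between (suc m) (s≤s p) = count-between m p

-- Maximal chains and sums over them.

-- A maximal chain of 2^[n+1] is a maximal chain S₀ ⊂ … ⊂ Sₙ of 2^[n] (on the
-- last n coordinates) with the step i ≤ n at which the first coordinate enters:
-- 0S₀, …, 0Sᵢ, 1Sᵢ, …, 1Sₙ.
Flag : ℕ → Set
Flag zero    = ⊤
Flag (suc n) = Flag n × ℕ

-- A chain has one member per size, so A can only be its member of size |A|. Hence 0A occurs among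
-- 0S₀, ..., 0Sᵢ when A is on the shorter chain and |A| ≤ i, and 1A among 1Sᵢ, ..., 1Sₙ when i ≤
-- |A|.
hits : ∀ {n} → Subset n → Flag n → Bool
hits []          ω       = true
hits (false ∷ A) (ω , i) = hits A ω ∧ (∣ A ∣ <ᵇ suc i)
hits (true  ∷ A) (ω , i) = hits A ω ∧ (i <ᵇ suc ∣ A ∣)

-- `Flag` puts no bound on its steps; the range i ≤ n is imposed here, so that exactly n! chains are
-- summed over.
∑ : ∀ n → (Flag n → ℕ) → ℕ
∑ zero    f = f tt
∑ (suc n) f = ∑ n λ ω → sum< (suc n) λ i → f (ω , i)

∑-mono : ∀ n {f g} → (∀ ω → f ω ≤ g ω) → ∑ n f ≤ ∑ n g
∑-mono zero    h = h tt
∑-mono (suc n) h = ∑-mono n λ ω → sum<-mono (suc n) λ i → h (ω , i)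

∑-cong : ∀ n {f g} → (∀ ω → f ω ≡ g ω) → ∑ n f ≡ ∑ n g
∑-cong n h = ≤-antisym (∑-mono n (≤-reflexive ∘ h)) (∑-mono n (≤-reflexive ∘ sym ∘ h))

∑-+ : ∀ n f g → ∑ n (λ ω → f ω + g ω) ≡ ∑ n f + ∑ n g
∑-+ zero    f g = refl
∑-+ (suc n) f g = trans (∑-cong n λ ω → sum<-+ (suc n) (λ i → f (ω , i)) (λ i → g (ω , i))) (∑-+ n _ _)

∑-* : ∀ n a f → ∑ n (λ ω → f ω * a) ≡ ∑ n f * a
∑-* zero    a f = refl
∑-* (suc n) a f = trans (∑-cong n λ ω → trans
  (trans (sum<-cong (suc n) λ i → *-comm (f (ω , i)) a) (sum<-* (suc n) a λ i → f (ω , i))) (*-comm a _)) (∑-* n a _)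

∑-0 : ∀ n → ∑ n (λ _ → 0) ≡ 0
∑-0 zero    = refl
∑-0 (suc n) = trans (∑-cong n λ _ → sum<-0 (suc n)) (∑-0 n)

-- Passing through a given set is a condition on the chain of the tail times a condition on the
-- step, so counts multiply.
∑-split : ∀ n {f : Flag (suc n) → ℕ} g h → (∀ ω i → f (ω , i) ≡ g ω * h i) →
  ∑ (suc n) f ≡ ∑ n g * sum< (suc n) h
∑-split n g h eq = trans
  (∑-cong n λ ω → trans (sum<-cong (suc n) (eq ω)) (sum<-* (suc n) (g ω) h)) (∑-* n _ g)

∑-1 : ∀ n → ∑ n (λ _ → 1) ≡ n !
∑-1 zero    = refl
∑-1 (suc n) = trans (∑-split n (λ _ → 1) (λ _ → 1) (λ _ _ → refl))
  (trans (cong₂ _*_ (∑-1 n) (sum<-1 (suc n))) (*-comm (n !) (suc n)))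

-- Counting the chains through one or two sets.

through : ∀ {n} → Subset n → ℕ
through {n} A = ∑ n λ ω → 𝟙 (hits A ω)

through₂ : ∀ {n} → Subset n → Subset n → ℕ
through₂ {n} A B = ∑ n λ ω → 𝟙 (hits A ω ∧ hits B ω)

-- A chain through A extends to one through 0A at the n + 1 - |A| steps i ≥ |A|, and to one through
-- 1A at the |A| + 1 steps i ≤ |A|.
through≡ : ∀ {n} (A : Subset n) → through A ≡ ∣ A ∣ ! * (n ∸ ∣ A ∣) !
through≡ [] = refl
through≡ {suc n} (false ∷ A) = begin
  through (false ∷ A)
    ≡⟨ ∑-split n _ (λ i → 𝟙 (∣ A ∣ <ᵇ suc i)) (λ ω i → 𝟙-∧ (hits A ω) _) ⟩
  through A * sum< (suc n) (λ i → 𝟙 (∣ A ∣ <ᵇ suc i))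
    ≡⟨ cong₂ _*_ (through≡ A) (trans (count-≥ ∣ A ∣ (suc n)) (+-∸-assoc 1 (∣p∣≤n A))) ⟩
  ∣ A ∣ ! * (n ∸ ∣ A ∣) ! * suc (n ∸ ∣ A ∣)
    ≡⟨ *-assoc (∣ A ∣ !) _ _ ⟩
  ∣ A ∣ ! * ((n ∸ ∣ A ∣) ! * suc (n ∸ ∣ A ∣))
    ≡⟨ cong (∣ A ∣ ! *_) (*-comm ((n ∸ ∣ A ∣) !) _) ⟩
  ∣ A ∣ ! * suc (n ∸ ∣ A ∣) !
    ≡⟨ cong (λ x → ∣ A ∣ ! * x !) (+-∸-assoc 1 (∣p∣≤n A)) ⟨
  ∣ A ∣ ! * (suc n ∸ ∣ A ∣) ! ∎
  where open ≡-Reasoning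
through≡ {suc n} (true ∷ A) = begin
  through (true ∷ A)
    ≡⟨ ∑-split n _ (λ i → 𝟙 (i <ᵇ suc ∣ A ∣)) (λ ω i → 𝟙-∧ (hits A ω) _) ⟩
  through A * sum< (suc n) (λ i → 𝟙 (i <ᵇ suc ∣ A ∣))
    ≡⟨ cong₂ _*_ (through≡ A) (trans (count-≤ ∣ A ∣ (suc n)) (m≤n⇒m⊓n≡m (s≤s (∣p∣≤n A)))) ⟩
  ∣ A ∣ ! * (n ∸ ∣ A ∣) ! * suc ∣ A ∣
    ≡⟨ lemma (∣ A ∣ !) _ _ ⟩
  suc ∣ A ∣ ! * (n ∸ ∣ A ∣) ! ∎
  where
  open ≡-Reasoning
  lemma : ∀ x y z → x * y * z ≡ z * x * y
  lemma = solve-∀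

through₂-∷ : ∀ {n} (A B : Subset n) (f g : ℕ → Bool) →
  ∑ (suc n) (λ (ω , i) → 𝟙 ((hits A ω ∧ f i) ∧ (hits B ω ∧ g i))) ≡ through₂ A B * sum< (suc n) (λ i → 𝟙 (f i ∧ g i))
through₂-∷ {n} A B f g = ∑-split n _ _ λ ω i →
  trans (cong 𝟙 (lemma (hits A ω) (hits B ω) (f i) (g i))) (𝟙-∧ (hits A ω ∧ hits B ω) (f i ∧ g i))
  where
  lemma : ∀ a b x y → (a ∧ x) ∧ (b ∧ y) ≡ (a ∧ b) ∧ (x ∧ y)
  lemma false b x y = refl
  lemma true false true  y = refl
  lemma true false false y = refl
  lemma true true  x y = refl

head-⊈ : ∀ {n} {A B : Subset n} → ¬ (true ∷ A) ⊆ (false ∷ B)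
head-⊈ s with s Vec.here
... | ()

-- The three factorials order the parts of the chain below A, between A and B, and above B. A new
-- coordinate outside B leaves the steps i ≥ |B|, one in B only leaves |A| ≤ i ≤ |B|, and one in A
-- leaves i ≤ |A|; each enlarges one factorial.
through₂≤ : ∀ {n} (A B : Subset n) → A ⊆ B →
  through₂ A B ≤ ∣ A ∣ ! * ((∣ B ∣ ∸ ∣ A ∣) ! * (n ∸ ∣ B ∣) !)
through₂≤ [] [] s = ≤-refl
through₂≤ {suc n} (false ∷ A) (false ∷ B) s = begin
  through₂ (false ∷ A) (false ∷ B)
    ≡⟨ through₂-∷ A B (λ i → a <ᵇ suc i) (λ i → b <ᵇ suc i) ⟩
  through₂ A B * sum< (suc n) (λ i → 𝟙 ((a <ᵇ suc i) ∧ (b <ᵇ suc i)))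
    ≤⟨ *-mono-≤ (through₂≤ A B (drop-∷-⊆ s)) (≤-trans (sum<-mono (suc n) (λ i → 𝟙-mono {(a <ᵇ suc i) ∧ (b <ᵇ suc i)} (proj₂ ∘ ∧-T {a <ᵇ suc i}))) (≤-reflexive (count-≥ b (suc n)))) ⟩
  a ! * ((b ∸ a) ! * (n ∸ b) !) * (suc n ∸ b)
    ≡⟨ cong (a ! * ((b ∸ a) ! * (n ∸ b) !) *_) e ⟩
  a ! * ((b ∸ a) ! * (n ∸ b) !) * suc (n ∸ b)
    ≡⟨ lemma (a !) ((b ∸ a) !) ((n ∸ b) !) _ ⟩
  a ! * ((b ∸ a) ! * (suc (n ∸ b)) !)
    ≡⟨ cong (λ x → a ! * ((b ∸ a) ! * x !)) e ⟨
  a ! * ((b ∸ a) ! * (suc n ∸ b) !) ∎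
  where
  open ≤-Reasoning
  a = ∣ A ∣
  b = ∣ B ∣
  e = +-∸-assoc 1 (∣p∣≤n B)
  lemma : ∀ x y z t → x * (y * z) * t ≡ x * (y * (t * z))
  lemma = solve-∀
through₂≤ {suc n} (false ∷ A) (true ∷ B) s = begin
  through₂ (false ∷ A) (true ∷ B)
    ≡⟨ through₂-∷ A B (λ i → a <ᵇ suc i) (λ i → i <ᵇ suc b) ⟩
  through₂ A B * sum< (suc n) (λ i → 𝟙 ((a <ᵇ suc i) ∧ (i <ᵇ suc b)))
    ≤⟨ *-mono-≤ (through₂≤ A B (drop-∷-⊆ s)) (count-between (suc n) a≤b) ⟩
  a ! * ((b ∸ a) ! * (n ∸ b) !) * suc (b ∸ a)
    ≡⟨ lemma (a !) ((b ∸ a) !) ((n ∸ b) !) _ ⟩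
  a ! * (suc (b ∸ a) ! * (n ∸ b) !)
    ≡⟨ cong (λ x → a ! * (x ! * (n ∸ b) !)) (+-∸-assoc 1 a≤b) ⟨
  a ! * ((suc b ∸ a) ! * (n ∸ b) !) ∎
  where
  open ≤-Reasoning
  a = ∣ A ∣
  b = ∣ B ∣
  a≤b = p⊆q⇒∣p∣≤∣q∣ (drop-∷-⊆ s)
  lemma : ∀ x y z t → x * (y * z) * t ≡ x * ((t * y) * z)
  lemma = solve-∀
through₂≤ {suc n} (true ∷ A) (true ∷ B) s = begin
  through₂ (true ∷ A) (true ∷ B)
    ≡⟨ through₂-∷ A B (λ i → i <ᵇ suc a) (λ i → i <ᵇ suc b) ⟩
  through₂ A B * sum< (suc n) (λ i → 𝟙 ((i <ᵇ suc a) ∧ (i <ᵇ suc b)))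
    ≤⟨ *-mono-≤ (through₂≤ A B (drop-∷-⊆ s)) (≤-trans (sum<-mono (suc n) (λ i → 𝟙-mono {(i <ᵇ suc a) ∧ (i <ᵇ suc b)} (proj₁ ∘ ∧-T {i <ᵇ suc a}))) (≤-trans (≤-reflexive (count-≤ a (suc n))) (m⊓n≤m (suc a) _))) ⟩
  a ! * ((b ∸ a) ! * (n ∸ b) !) * suc a
    ≡⟨ lemma (a !) ((b ∸ a) !) ((n ∸ b) !) _ ⟩
  suc a ! * ((b ∸ a) ! * (n ∸ b) !) ∎
  where
  open ≤-Reasoning
  a = ∣ A ∣
  b = ∣ B ∣
  lemma : ∀ x y z t → x * (y * z) * t ≡ (t * x) * (y * z)
  lemma = solve-∀
through₂≤ (true ∷ A) (false ∷ B) s = ⊥-elim (head-⊈ s)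

hits-⊆ : ∀ {n} (A B : Subset n) ω → T (hits A ω) → T (hits B ω) → ∣ A ∣ ≤ ∣ B ∣ → A ⊆ B
hits-⊆ [] [] ω _ _ _ = id
hits-⊆ (false ∷ A) (false ∷ B) (ω , i) p q le =
  out⊆ (hits-⊆ A B ω (proj₁ (∧-T p)) (proj₁ (∧-T q)) le)
hits-⊆ (true ∷ A) (true ∷ B) (ω , i) p q le =
  in⊆in (hits-⊆ A B ω (proj₁ (∧-T p)) (proj₁ (∧-T q)) (≤-pred le))
-- The hypothesis on sizes only gives |A| ≤ |B| + 1 for the tails; the step i supplies |A| ≤ i ≤
-- |B|.
hits-⊆ (false ∷ A) (true ∷ B) (ω , i) p q le
  with p₁ , p₂ ← ∧-T {hits A ω} p | q₁ , q₂ ← ∧-T {hits B ω} q =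
  out⊆ (hits-⊆ A B ω p₁ q₁ (≤-trans (≤-pred (<ᵇ⇒< _ _ p₂)) (≤-pred (<ᵇ⇒< _ _ q₂))))
hits-⊆ (true ∷ A) (false ∷ B) (ω , i) p q le
  with p₁ , p₂ ← ∧-T {hits A ω} p | q₁ , q₂ ← ∧-T {hits B ω} q =
  contradiction (≤-trans (≤-trans le (≤-pred (<ᵇ⇒< _ _ q₂))) (≤-pred (<ᵇ⇒< _ _ p₂))) 1+n≰n

⊆∧∣≥∣⇒≡ : ∀ {n} {A B : Subset n} → A ⊆ B → ∣ B ∣ ≤ ∣ A ∣ → A ≡ B
⊆∧∣≥∣⇒≡ {A = []} {[]} s le = refl
⊆∧∣≥∣⇒≡ {A = false ∷ A} {false ∷ B} s le = cong (false ∷_) (⊆∧∣≥∣⇒≡ (drop-∷-⊆ s) le)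
⊆∧∣≥∣⇒≡ {A = true ∷ A} {true ∷ B} s le = cong (true ∷_) (⊆∧∣≥∣⇒≡ (drop-∷-⊆ s) (≤-pred le))
⊆∧∣≥∣⇒≡ {A = false ∷ A} {true ∷ B} s le =
  contradiction (≤-trans le (p⊆q⇒∣p∣≤∣q∣ (drop-∷-⊆ s))) 1+n≰n
⊆∧∣≥∣⇒≡ {A = true ∷ A} {false ∷ B} s le = ⊥-elim (head-⊈ s)

hits-≡ : ∀ {n} {A B : Subset n} ω → T (hits A ω) → T (hits B ω) → ∣ A ∣ ≡ ∣ B ∣ → A ≡ B
hits-≡ {A = A} {B} ω p q eq = ⊆∧∣≥∣⇒≡ (hits-⊆ A B ω p q (≤-reflexive eq)) (≤-reflexive (sym eq))

T-∧⁺ : ∀ {a b} → T a → T b → T (a ∧ b)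
T-∧⁺ p q = Equivalence.from T-∧ (p , q)

!*!≤! : ∀ r s → suc r ! * suc s ! ≤ suc (r + s) !
!*!≤! r zero = ≤-reflexive (trans (*-identityʳ _) (cong (λ x → suc x !) (sym (+-identityʳ r))))
!*!≤! r (suc s) = begin
  suc r ! * (suc (suc s) * suc s !)
    ≡⟨ lemma (suc r !) (suc (suc s)) (suc s !) ⟩
  suc (suc s) * (suc r ! * suc s !)
    ≤⟨ *-mono-≤ {suc (suc s)} {suc (suc (r + s))} (s≤s (s≤s (m≤n+m s r))) (!*!≤! r s) ⟩
  suc (suc (r + s)) !
    ≡⟨ cong (λ x → suc x !) (sym (+-suc r s)) ⟩
  suc (r + suc s) ! ∎
  where
  open ≤-Reasoning
  lemma : ∀ x y z → x * (y * z) ≡ y * (x * z)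
  lemma = solve-∀

-- The binomial coefficient of r + s over r is at least r + s when r and s are positive. The
-- fraction that one set can take from another comes from here.
[r+s]*r!*s!≤[r+s]! : ∀ {r s} → 0 < r → 0 < s → (r + s) * (r ! * s !) ≤ (r + s) !
[r+s]*r!*s!≤[r+s]! {suc r} {suc s} _ _ = *-monoʳ-≤ (suc (r + suc s))
  (≤-trans (!*!≤! r s) (≤-reflexive (cong _! (sym (+-suc r s)))))

through₂-comm : ∀ {n} (A B : Subset n) → through₂ A B ≡ through₂ B A
through₂-comm {n} A B = ∑-cong n λ ω → cong 𝟙 (∧-comm (hits A ω) (hits B ω))

through₂≡0 : ∀ {n} (A B : Subset n) → (∀ ω → T (hits A ω) → ¬ T (hits B ω)) → through₂ A B ≡ 0
through₂≡0 {n} A B h = n≤0⇒n≡0 (≤-trans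
  (∑-mono n λ ω → 𝟙-mono {hits A ω ∧ hits B ω} {false} λ p → h ω (proj₁ (∧-T p)) (proj₂ (∧-T {hits A ω} p)))
  (≤-reflexive (∑-0 n)))

-- If A ⊆ B, then among the (n - a)! ways to continue a chain above A, (b - a)! (n - b)! pass
-- through B. Both b - a and n - b are positive, as A ≠ B and B is not full.
through₂-up : ∀ {n} (A B : Subset n) → A ≢ B → ∣ A ∣ ≤ ∣ B ∣ → ∣ B ∣ < n → (n ∸ ∣ A ∣) * through₂ A B ≤ through A
through₂-up {n} A B A≢B a≤b b<n with A ⊆? B
... | no  A⊈B = ≤-trans (≤-reflexive (trans
  (cong ((n ∸ ∣ A ∣) *_) (through₂≡0 A B λ ω p q → A⊈B (hits-⊆ A B ω p q a≤b))) (*-zeroʳ (n ∸ ∣ A ∣)))) z≤n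
... | yes A⊆B = begin
  (n ∸ a) * through₂ A B
    ≤⟨ *-monoʳ-≤ (n ∸ a) (through₂≤ A B A⊆B) ⟩
  (n ∸ a) * (a ! * ((b ∸ a) ! * (n ∸ b) !))
    ≡⟨ lemma (n ∸ a) (a !) _ ⟩
  a ! * ((n ∸ a) * ((b ∸ a) ! * (n ∸ b) !))
    ≡⟨ cong (λ x → a ! * (x * ((b ∸ a) ! * (n ∸ b) !))) r+s ⟨
  a ! * ((b ∸ a + (n ∸ b)) * ((b ∸ a) ! * (n ∸ b) !))
    ≤⟨ *-monoʳ-≤ (a !) ([r+s]*r!*s!≤[r+s]! (m<n⇒0<n∸m a<b) (m<n⇒0<n∸m b<n)) ⟩
  a ! * (b ∸ a + (n ∸ b)) !
    ≡⟨ cong (λ x → a ! * x !) r+s ⟩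
  a ! * (n ∸ a) !
    ≡⟨ through≡ A ⟨
  through A ∎
  where
  open ≤-Reasoning
  a = ∣ A ∣
  b = ∣ B ∣
  a<b : a < b
  a<b = ≰⇒> λ b≤a → A≢B (⊆∧∣≥∣⇒≡ A⊆B b≤a)
  r+s : b ∸ a + (n ∸ b) ≡ n ∸ a
  r+s = trans (sym (+-∸-comm (n ∸ b) a≤b)) (cong (_∸ a) (m+[n∸m]≡n (<⇒≤ b<n)))
  lemma : ∀ x y z → x * (y * z) ≡ y * (x * z)
  lemma = solve-∀

through₂-down : ∀ {n} (A B : Subset n) → A ≢ B → ∣ B ∣ ≤ ∣ A ∣ → 0 < ∣ B ∣ → ∣ A ∣ * through₂ A B ≤ through A
through₂-down {n} A B A≢B b≤a 0<b with B ⊆? A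
... | no  B⊈A = ≤-trans (≤-reflexive (trans
  (cong (∣ A ∣ *_) (through₂≡0 A B λ ω p q → B⊈A (hits-⊆ B A ω q p b≤a))) (*-zeroʳ ∣ A ∣))) z≤n
... | yes B⊆A = begin
  a * through₂ A B
    ≡⟨ cong (a *_) (through₂-comm A B) ⟩
  a * through₂ B A
    ≤⟨ *-monoʳ-≤ a (through₂≤ B A B⊆A) ⟩
  a * (b ! * ((a ∸ b) ! * (n ∸ a) !))
    ≡⟨ lemma a (b !) _ _ ⟩
  a * (b ! * (a ∸ b) !) * (n ∸ a) !
    ≡⟨ cong (λ x → x * (b ! * (a ∸ b) !) * (n ∸ a) !) (m+[n∸m]≡n b≤a) ⟨
  (b + (a ∸ b)) * (b ! * (a ∸ b) !) * (n ∸ a) !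
    ≤⟨ *-monoˡ-≤ ((n ∸ a) !) ([r+s]*r!*s!≤[r+s]! 0<b (m<n⇒0<n∸m b<a)) ⟩
  (b + (a ∸ b)) ! * (n ∸ a) !
    ≡⟨ cong (λ x → x ! * (n ∸ a) !) (m+[n∸m]≡n b≤a) ⟩
  a ! * (n ∸ a) !
    ≡⟨ through≡ A ⟨
  through A ∎
  where
  open ≤-Reasoning
  a = ∣ A ∣
  b = ∣ B ∣
  b<a : b < a
  b<a = ≰⇒> λ a≤b → A≢B (sym (⊆∧∣≥∣⇒≡ B⊆A a≤b))
  lemma : ∀ x y z t → x * (y * (z * t)) ≡ x * (y * z) * t
  lemma = solve-∀

-- Distance from the middle level.

-- For n = 2k this is k + d, where d is the distance to the middle level; it treats the levels k + d
-- and k - d at once.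
height : ∀ {n} → Subset n → ℕ
height {n} A = ∣ A ∣ ⊔ (n ∸ ∣ A ∣)

through≡height : ∀ {n} (A : Subset n) → through A ≡ height A ! * (n ∸ height A) !
through≡height {n} A with ≤-total (∣ A ∣) (n ∸ ∣ A ∣)
... | inj₁ le rewrite m≤n⇒m⊔n≡n le | m∸[m∸n]≡n (∣p∣≤n A) = trans (through≡ A) (*-comm (∣ A ∣ !) _)
... | inj₂ ge rewrite m≥n⇒m⊔n≡m ge = through≡ A

-- B is no farther from the middle than A, so |B| lies between n - `height A` and `height A`, and
-- |A| is an end of this range. At the low end B can only be above A, at the high end only below;
-- `height A < n` keeps B from being empty or full.
charge : ∀ {n} (A B : Subset n) → A ≢ B → height B ≤ height A → height A < n →
  height A * through₂ A B ≤ through A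
charge {n} A B A≢B hB≤hA hA<n with ≤-total (∣ A ∣) (n ∸ ∣ A ∣)
... | inj₁ le rewrite m≤n⇒m⊔n≡n le = through₂-up A B A≢B
  (∸-cancelʳ-≤ (∣p∣≤n A) (≤-trans (m≤n⊔m ∣ B ∣ _) hB≤hA))
  (≤-<-trans (≤-trans (m≤m⊔n ∣ B ∣ _) hB≤hA) hA<n)
... | inj₂ ge rewrite m≥n⇒m⊔n≡m ge = through₂-down A B A≢B
  (≤-trans (m≤m⊔n ∣ B ∣ _) hB≤hA)
  (n≢0⇒n>0 λ b≡0 → <⇒≱ hA<n (subst (λ b → n ∸ b ≤ ∣ A ∣) b≡0 (≤-trans (m≤n⊔m ∣ B ∣ _) hB≤hA)))

-- Chains that meet a family.

meets : ∀ {n} → List (Subset n) → Flag n → Bool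
meets P ω = any (λ A → hits A ω) P

meets⁺ : ∀ {n} {P : List (Subset n)} {A} ω → A ∈ P → T (hits A ω) → T (meets P ω)
meets⁺ ω A∈P p = any⁺ _ (lose A∈P p)

meets⁻ : ∀ {n} (P : List (Subset n)) ω → T (meets P ω) → ∃ λ A → A ∈ P × T (hits A ω)
meets⁻ P ω p = find (any⁻ _ P p)

meeting : ∀ {n} → List (Subset n) → ℕ
meeting {n} P = ∑ n λ ω → 𝟙 (meets P ω)

meeting≤n! : ∀ {n} (P : List (Subset n)) → meeting P ≤ n !
meeting≤n! {n} P = ≤-trans (∑-mono n λ ω → 𝟙-mono {meets P ω} {true} _) (≤-reflexive (∑-1 n))

meeting-mono : ∀ {n} {P Q : List (Subset n)} → (∀ {A} → A ∈ P → A ∈ Q) → meeting P ≤ meeting Q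
meeting-mono {n} {P} {Q} P⊆Q = ∑-mono n λ ω → 𝟙-mono λ p →
  let A , A∈P , q = meets⁻ P ω p in meets⁺ {P = Q} ω (P⊆Q A∈P) q

meeting-disjoint : ∀ {n} (P Q R : List (Subset n)) → (∀ {A} → A ∈ P → A ∈ R) → (∀ {A} → A ∈ Q → A ∈ R) →
  (∀ {A B} ω → A ∈ P → B ∈ Q → T (hits A ω) → ¬ T (hits B ω)) → meeting P + meeting Q ≤ meeting R
meeting-disjoint {n} P Q R P⊆R Q⊆R disj = ≤-trans (≤-reflexive (sym (∑-+ n _ _))) (∑-mono n bound)
  where
  bound : ∀ ω → 𝟙 (meets P ω) + 𝟙 (meets Q ω) ≤ 𝟙 (meets R ω)
  bound ω with meets P ω in eqP | meets Q ω in eqQ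
  ... | false | false = z≤n
  ... | true | false = 𝟙-mono {true} λ _ →
    let A , A∈P , p = meets⁻ P ω (Equivalence.from T-≡ eqP) in meets⁺ ω (P⊆R A∈P) p
  ... | false | true = 𝟙-mono {true} λ _ →
    let A , A∈Q , p = meets⁻ Q ω (Equivalence.from T-≡ eqQ) in meets⁺ ω (Q⊆R A∈Q) p
  ... | true | true =
    let A , A∈P , p = meets⁻ P ω (Equivalence.from T-≡ eqP)
        B , B∈Q , q = meets⁻ Q ω (Equivalence.from T-≡ eqQ)
    in ⊥-elim (disj ω A∈P B∈Q p q)

∑-pairs : ∀ {n} (A : Subset n) Q → ∑ n (λ ω → sum (map (λ B → 𝟙 (hits A ω ∧ hits B ω)) Q)) ≡ sum (map (through₂ A) Q)
∑-pairs {n} A [] = ∑-0 n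
∑-pairs {n} A (B ∷ Q) = trans (∑-+ n _ _) (cong (through₂ A B +_) (∑-pairs A Q))

∑-∧-any : ∀ {n} (A : Subset n) Q ω → T (hits A ω) → 𝟙 (meets Q ω) ≤ sum (map (λ B → 𝟙 (hits A ω ∧ hits B ω)) Q)
∑-∧-any A [] ω p = z≤n
∑-∧-any A (B ∷ Q) ω p with hits A ω in eq | hits B ω
... | true | true  = s≤s z≤n
... | true | false = ≤-trans (∑-∧-any A Q ω (Equivalence.from T-≡ eq)) (≤-reflexive (cong (λ x → sum (map (λ B → 𝟙 (x ∧ hits B ω)) Q)) eq))

-- Bonferroni, where Q may omit those members of P that meet A only in chains
-- that also pass through Q.
gain : ∀ {n} (A : Subset n) P Q → (∀ ω → T (hits A ω) → T (meets P ω) → T (meets Q ω)) →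
  meeting P + through A ≤ meeting (A ∷ P) + sum (map (through₂ A) Q)
gain {n} A P Q h = ≤-trans (≤-reflexive (sym (∑-+ n _ _)))
  (≤-trans (∑-mono n bound) (≤-reflexive (trans (∑-+ n _ _) (cong (meeting (A ∷ P) +_) (∑-pairs A Q)))))
  where
  bound : ∀ ω → 𝟙 (meets P ω) + 𝟙 (hits A ω) ≤
    𝟙 (hits A ω ∨ meets P ω) + sum (map (λ B → 𝟙 (hits A ω ∧ hits B ω)) Q)
  bound ω with h ω | ∑-∧-any A Q ω
  ... | f | g with hits A ω | meets P ω
  ... | false | b = ≤-trans (≤-reflexive (+-identityʳ _)) (m≤m+n _ _)
  ... | true | false = s≤s z≤n
  -- A chain through A that meets P counts twice on the left; by `h` it meets Q, so the sum over Q
  -- supplies the second unit.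
  ... | true | true = s≤s (≤-trans (𝟙-mono {true} λ _ → f tt tt) (g tt))

-- Diamonds and incomparable pairs.

-- The diamond 0X, 0A, 1B, 1Y: sizes force X = B and A = Y. The chain of the tail contains both, and
-- the first coordinate enters either at a step i ≤ |X|, so that 1B is passed, or later, so that 0A
-- is passed.
between-mixed : ∀ {n} (X A B Y : Subset n) ω i → X ⊆ B → A ⊆ Y → ∣ A ∣ ≡ suc ∣ X ∣ → ∣ B ∣ ≡ ∣ X ∣ → ∣ Y ∣ ≡ suc ∣ X ∣ →
  T (hits (false ∷ X) (ω , i)) → T (hits (true ∷ Y) (ω , i)) →
  T (hits (false ∷ A) (ω , i)) ⊎ T (hits (true ∷ B) (ω , i))
between-mixed X A B Y ω i X⊆B A⊆Y a b y p q
  with p₁ , p₂ ← ∧-T {hits X ω} p | q₁ , q₂ ← ∧-T {hits Y ω} q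
  with refl ← ⊆∧∣≥∣⇒≡ X⊆B (≤-reflexive b) | refl ← ⊆∧∣≥∣⇒≡ A⊆Y (≤-reflexive (trans y (sym a)))
  with ≤-<-connex i (∣ X ∣)
... | inj₁ i≤x = inj₂ (T-∧⁺ p₁ (<⇒<ᵇ (s≤s i≤x)))
... | inj₂ x<i = inj₁ (T-∧⁺ q₁ (<⇒<ᵇ (s≤s (≤-trans (≤-reflexive a) x<i))))

-- Only two sets lie strictly between X and Y, and they are A and B. Coordinates in X or outside Y
-- are stripped off; at the first one in Y but not in X, A and B must differ, since otherwise their
-- tails would coincide.
between : ∀ {n} (X A B Y : Subset n) ω → X ⊆ A → X ⊆ B → A ⊆ Y → B ⊆ Y → A ≢ B →
  ∣ A ∣ ≡ suc ∣ X ∣ → ∣ B ∣ ≡ suc ∣ X ∣ → ∣ Y ∣ ≡ suc (suc ∣ X ∣) →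
  T (hits X ω) → T (hits Y ω) → T (hits A ω) ⊎ T (hits B ω)
between [] [] [] [] ω _ _ _ _ A≢B _ _ _ _ _ = contradiction refl A≢B
between (true ∷ X) (true ∷ A) (true ∷ B) (true ∷ Y) (ω , i) s t u v A≢B a b y p q
  with p₁ , p₂ ← ∧-T {hits X ω} p | q₁ , q₂ ← ∧-T {hits Y ω} q
  with between X A B Y ω (drop-∷-⊆ s) (drop-∷-⊆ t) (drop-∷-⊆ u) (drop-∷-⊆ v) (A≢B ∘ cong (true ∷_))
    (suc-injective a) (suc-injective b) (suc-injective y) p₁ q₁
... | inj₁ r = inj₁ (T-∧⁺ r (<⇒<ᵇ (≤-trans (<ᵇ⇒< i _ p₂) (s≤s (p⊆q⇒∣p∣≤∣q∣ (drop-∷-⊆ s))))))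
... | inj₂ r = inj₂ (T-∧⁺ r (<⇒<ᵇ (≤-trans (<ᵇ⇒< i _ p₂) (s≤s (p⊆q⇒∣p∣≤∣q∣ (drop-∷-⊆ t))))))
between (false ∷ X) (false ∷ A) (false ∷ B) (false ∷ Y) (ω , i) s t u v A≢B a b y p q
  with p₁ , p₂ ← ∧-T {hits X ω} p | q₁ , q₂ ← ∧-T {hits Y ω} q
  with between X A B Y ω (drop-∷-⊆ s) (drop-∷-⊆ t) (drop-∷-⊆ u) (drop-∷-⊆ v) (A≢B ∘ cong (false ∷_)) a b y p₁ q₁
... | inj₁ r = inj₁ (T-∧⁺ r (<⇒<ᵇ (≤-<-trans (p⊆q⇒∣p∣≤∣q∣ (drop-∷-⊆ u)) (<ᵇ⇒< (∣ Y ∣) (suc i) q₂))))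
... | inj₂ r = inj₂ (T-∧⁺ r (<⇒<ᵇ (≤-<-trans (p⊆q⇒∣p∣≤∣q∣ (drop-∷-⊆ v)) (<ᵇ⇒< (∣ Y ∣) (suc i) q₂))))
between (false ∷ X) (false ∷ A) (false ∷ B) (true ∷ Y) (ω , i) s t u v A≢B a b y p q =
  contradiction (cong (false ∷_) (trans (eq (drop-∷-⊆ u) a) (sym (eq (drop-∷-⊆ v) b)))) A≢B
  where
  eq : ∀ {Z} → Z ⊆ Y → ∣ Z ∣ ≡ suc ∣ X ∣ → Z ≡ Y
  eq Z⊆Y z = ⊆∧∣≥∣⇒≡ Z⊆Y (≤-reflexive (trans (suc-injective y) (sym z)))
between (false ∷ X) (true ∷ A) (true ∷ B) (true ∷ Y) (ω , i) s t u v A≢B a b y p q =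
  contradiction (cong (true ∷_) (trans (sym (eq (drop-∷-⊆ s) a)) (eq (drop-∷-⊆ t) b))) A≢B
  where
  eq : ∀ {Z} → X ⊆ Z → suc ∣ Z ∣ ≡ suc ∣ X ∣ → X ≡ Z
  eq X⊆Z z = ⊆∧∣≥∣⇒≡ X⊆Z (≤-reflexive (suc-injective z))
between (false ∷ X) (false ∷ A) (true ∷ B) (true ∷ Y) (ω , i) s t u v A≢B a b y p q =
  between-mixed X A B Y ω i (drop-∷-⊆ t) (drop-∷-⊆ u) a (suc-injective b) (suc-injective y) p q
between (false ∷ X) (true ∷ A) (false ∷ B) (true ∷ Y) (ω , i) s t u v A≢B a b y p q =
  Sum.swap (between-mixed X B A Y ω i (drop-∷-⊆ s) (drop-∷-⊆ v) b (suc-injective a) (suc-injective y) p q)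
between (true ∷ X) (false ∷ A) _ _ _ s _ _ _ _ _ _ _ _ _ = ⊥-elim (head-⊈ s)
between (true ∷ X) (true ∷ A) (false ∷ B) _ _ s t _ _ _ _ _ _ _ _ = ⊥-elim (head-⊈ t)
between (true ∷ X) (true ∷ A) (true ∷ B) (false ∷ Y) _ s t u _ _ _ _ _ _ _ = ⊥-elim (head-⊈ u)
between (false ∷ X) (true ∷ A) _ (false ∷ Y) _ s t u _ _ _ _ _ _ _ = ⊥-elim (head-⊈ u)
between (false ∷ X) (false ∷ A) (true ∷ B) (false ∷ Y) _ s t u v _ _ _ _ _ _ = ⊥-elim (head-⊈ v)

-- This amounts to incomparability, in the form that lets a pair be dropped from the Bonferroni sum.
record Disjoint {n} (A B : Subset n) : Set where
  constructor disjoint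
  field
    apart : ∀ ω → T (hits A ω) → ¬ T (hits B ω)

open Disjoint

Disjoint-sym : ∀ {n} {A B : Subset n} → Disjoint A B → Disjoint B A
Disjoint-sym d = disjoint λ ω p q → apart d ω q p

equal-size⇒Disjoint : ∀ {n} {A B : Subset n} → A ≢ B → ∣ A ∣ ≡ ∣ B ∣ → Disjoint A B
equal-size⇒Disjoint A≢B eq = disjoint λ ω p q → A≢B (hits-≡ ω p q eq)

⊈⇒Disjoint : ∀ {n} {A B : Subset n} → ¬ A ⊆ B → ∣ A ∣ ≤ ∣ B ∣ → Disjoint A B
⊈⇒Disjoint A⊈B le = disjoint λ ω p q → A⊈B (hits-⊆ _ _ ω p q le)

meets-drop : ∀ {n} {A : Subset n} P Q → All (λ B → B ∈ Q ⊎ Disjoint A B) P →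
  ∀ ω → T (hits A ω) → T (meets P ω) → T (meets Q ω)
meets-drop P Q ds ω p m with meets⁻ P ω m
... | B , B∈P , q with All.lookup ds B∈P
... | inj₁ B∈Q = meets⁺ {P = Q} ω B∈Q q
... | inj₂ d   = contradiction q (apart d ω p)

sum-through₂≤ : ∀ {n w} m (A : Subset n) Q → All (λ B → m * through₂ A B ≤ w) Q → m * sum (map (through₂ A) Q) ≤ length Q * w
sum-through₂≤ m A [] [] = ≤-reflexive (*-zeroʳ m)
sum-through₂≤ m A (B ∷ Q) (le ∷ les) =
  ≤-trans (≤-reflexive (*-distribˡ-+ m (through₂ A B) _)) (+-mono-≤ le (sum-through₂≤ m A Q les))

-- Passing from h to h + 1 replaces a factor n - h by h + 1, which is no smaller because n ≤ 2h.
!*!-mono : ∀ h j n → n ≤ h + h → h + j ≤ n → h ! * (n ∸ h) ! ≤ (h + j) ! * (n ∸ (h + j)) !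
!*!-mono h zero n n≤2h h+j≤n rewrite +-identityʳ h = ≤-refl
!*!-mono h (suc j) n n≤2h h+j≤n = begin
  h ! * (n ∸ h) !
    ≡⟨ cong (λ x → h ! * x !) e ⟩
  h ! * (suc (n ∸ suc h) * (n ∸ suc h) !)
    ≡⟨ lemma (h !) (suc (n ∸ suc h)) ((n ∸ suc h) !) ⟩
  suc (n ∸ suc h) * h ! * (n ∸ suc h) !
    ≤⟨ *-monoˡ-≤ ((n ∸ suc h) !) {suc (n ∸ suc h) * h !} {suc h !} (*-monoˡ-≤ (h !) {suc (n ∸ suc h)} {suc h} r≤) ⟩
  suc h ! * (n ∸ suc h) !
    ≤⟨ !*!-mono (suc h) j n (≤-trans n≤2h (≤-trans (n≤1+n _) (+-monoʳ-≤ (suc h) (n≤1+n h)))) (subst (_≤ n) (+-suc h j) h+j≤n) ⟩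
  (suc h + j) ! * (n ∸ (suc h + j)) !
    ≡⟨ cong (λ x → x ! * (n ∸ x) !) (+-suc h j) ⟨
  (h + suc j) ! * (n ∸ (h + suc j)) ! ∎
  where
  open ≤-Reasoning
  h<n : h < n
  h<n = ≤-trans (≤-trans (s≤s (m≤m+n h j)) (≤-reflexive (sym (+-suc h j)))) h+j≤n
  e : n ∸ h ≡ suc (n ∸ suc h)
  e = +-∸-assoc 1 h<n
  r≤ : suc (n ∸ suc h) ≤ suc h
  r≤ = ≤-trans (≤-reflexive (sym e)) (≤-trans (m≤n+o⇒m∸n≤o n h n≤2h) (n≤1+n h))
  lemma : ∀ x y z → x * (y * z) ≡ y * x * z
  lemma = solve-∀

-- Shares of chains for n = 2k, and sets far from the middle.

module _ (k′ : ℕ) where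

  private
    -- w is the unit in which chains are counted, and t is twice the share of the
    -- n! chains that each set has to contribute.
    k n w t : ℕ
    k = suc k′
    n = k + k
    w = k ! * k′ !
    t = (k′ + k) * w

  -- This calibrates t: if each set accounts for t/2 of the n! chains, there are at most 2 n!/t
  -- sets, which is the bound of the theorem.
  4*C*t≡2*n! : 4 * ((k′ + k′) C k′) * t ≡ 2 * n !
  4*C*t≡2*n! = begin
    4 * b * ((k′ + k) * (k * k′ ! * k′ !))
      ≡⟨ lemma b k′ (k′ !) ⟩
    2 * ((k + k) * ((k′ + k) * (b * (k′ ! * k′ !))))
      ≡⟨ cong (λ x → 2 * ((k + k) * ((k′ + k) * x))) b* ⟩
    2 * ((k + k) * ((k′ + k) * (k′ + k′) !))
      ≡⟨ cong (λ x → 2 * ((k + k) * x)) step₁ ⟩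
    2 * n ! ∎
    where
    open ≡-Reasoning
    b = (k′ + k′) C k′
    b* : b * (k′ ! * k′ !) ≡ (k′ + k′) !
    b* = trans (cong₂ _*_ (nCk≡n!/k![n-k]! (m≤m+n k′ k′)) (cong (λ x → k′ ! * x !) (sym (m+n∸n≡m k′ k′))))
      (m/n*n≡m {{k′ !* (k′ + k′ ∸ k′) !≢0}} (subst (_∣ (k′ + k′) !) (*-comm ((k′ + k′ ∸ k′) !) _) ([n∸k]!k!∣n! (m≤m+n k′ k′))))
    step₁ : (k′ + k) * (k′ + k′) ! ≡ (k′ + k) !
    step₁ rewrite +-suc k′ k′ = refl
    lemma : ∀ b k′ f → 4 * b * ((k′ + suc k′) * (suc k′ * f * f)) ≡ 2 * ((suc k′ + suc k′) * ((k′ + suc k′) * (b * (f * f))))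
    lemma = solve-∀

  4*t≤2*n! : 4 * t ≤ 2 * n !
  4*t≤2*n! with (k′ + k′) C k′ | 4*C*t≡2*n!
  ... | zero  | eq = contradiction (sym eq) (≢-nonZero⁻¹ (2 * n !) {{m*n≢0 2 (n !) {{_}} {{n !≢0}}}})
  ... | suc b | eq = ≤-trans (*-monoˡ-≤ t (≤-trans (m≤m*n 4 (suc b)) ≤-refl)) (≤-reflexive eq)

  Heavy : List (Subset n) → Set
  Heavy P = length P * t ≤ 2 * meeting P

  k≤height : (A : Subset n) → k ≤ height A
  k≤height A with ≤-<-connex k ∣ A ∣
  ... | inj₁ le = ≤-trans le (m≤m⊔n ∣ A ∣ _)
  ... | inj₂ gt = ≤-trans (m+n≤o⇒m≤o∸n k (+-monoʳ-≤ k (<⇒≤ gt))) (m≤n⊔m ∣ A ∣ _)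

  height≤n : (A : Subset n) → height A ≤ n
  height≤n A = ⊔-lub (∣p∣≤n A) (m∸n≤m n ∣ A ∣)

  height≡⇒ : ∀ {h} (A : Subset n) → height A ≡ h → ∣ A ∣ ≡ h ⊎ ∣ A ∣ ≡ n ∸ h
  height≡⇒ A eq with ≤-total (∣ A ∣) (n ∸ ∣ A ∣)
  ... | inj₁ le rewrite m≤n⇒m⊔n≡n le = inj₂ (trans (sym (m∸[m∸n]≡n (∣p∣≤n A))) (cong (n ∸_) eq))
  ... | inj₂ ge rewrite m≥n⇒m⊔n≡m ge = inj₁ eq

  mid-size : ∀ (A : Subset n) → height A ≡ k → ∣ A ∣ ≡ k
  mid-size A eq = [ id , (λ e → trans e (m+n∸n≡m k k)) ]′ (height≡⇒ A eq)

  off-size : ∀ (A : Subset n) → height A ≡ suc k → ∣ A ∣ ≡ k′ ⊎ ∣ A ∣ ≡ suc k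
  off-size A eq = [ inj₂ , (λ e → inj₁ (trans e n∸)) ]′ (height≡⇒ A eq)
    where
    n∸ : n ∸ suc k ≡ k′
    n∸ = m+n∸n≡m k′ k

  through-mid : ∀ (A : Subset n) → height A ≡ k → through A ≡ k * w
  through-mid A eq = trans (through≡height A) (trans (cong (λ h → h ! * (n ∸ h) !) eq)
    (trans (cong (λ x → k ! * x !) (m+n∸n≡m k k)) (lemma (k !) k (k′ !))))
    where
    lemma : ∀ x y z → x * (y * z) ≡ y * (x * z)
    lemma = solve-∀

  through-off : ∀ (A : Subset n) → height A ≡ suc k → through A ≡ suc k * w
  through-off A eq = trans (through≡height A) (trans (cong (λ h → h ! * (n ∸ h) !) eq)
    (trans (cong (λ x → suc k ! * x !) (m+n∸n≡m k′ k)) (*-assoc (suc k) (k !) (k′ !))))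

  -- A is empty or full, hence on all n! chains, and these cover four shares.
  full-heavy : ∀ (A : Subset n) R → height A ≡ n → length R ≤ 3 → Heavy (A ∷ R)
  full-heavy A R full len = begin
    suc (length R) * t
      ≤⟨ *-monoˡ-≤ t (s≤s len) ⟩
    4 * t
      ≤⟨ 4*t≤2*n! ⟩
    2 * n !
      ≡⟨ cong (2 *_) through≡n! ⟨
    2 * through A
      ≤⟨ *-monoʳ-≤ 2 (∑-mono n λ ω → 𝟙-mono {hits A ω} λ p → meets⁺ {P = A ∷ R} ω (here refl) p) ⟩
    2 * meeting (A ∷ R) ∎
    where
    open ≤-Reasoning
    through≡n! : through A ≡ n !
    through≡n! = trans (through≡height A) (trans (cong (λ h → h ! * (n ∸ h) !) full)
      (trans (cong (λ x → n ! * x !) (n∸n≡0 n)) (*-identityʳ (n !))))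

  -- Three other sets take at most 3/(k + 2) of the chains through A; the remaining k′/(k + 2)
  -- should still be k! k! = `k * w` chains. At height k + 2 this holds because k′ (k + 2)! (k - 2)!
  -- = (k + 2)(k + 1) `w`, and greater heights carry at least as many chains.
  far-through : ∀ (A : Subset n) → 2 + k ≤ height A → (2 + k) * (k * w) ≤ k′ * through A
  far-through A far with m≤n⇒∃[o]m+o≡n far | ≤-trans far (height≤n A)
  ... | j , eq | 2+k≤n = begin
    (2 + k) * (k * (k ! * k′ !))
      ≤⟨ *-monoʳ-≤ (2 + k) (*-monoˡ-≤ (k ! * k′ !) (n≤1+n k)) ⟩
    (2 + k) * (suc k * (k ! * k′ !))
      ≡⟨ cong (λ x → (2 + k) * (suc k * (k ! * x))) k′!≡ ⟩
    (2 + k) * (suc k * (k ! * (k′ * (n ∸ (2 + k)) !)))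
      ≡⟨ lemma (2 + k) (suc k) (k !) k′ _ ⟩
    k′ * ((2 + k) ! * (n ∸ (2 + k)) !)
      ≤⟨ *-monoʳ-≤ k′ (!*!-mono (2 + k) j n (+-mono-≤ (m≤n+m k 2) (m≤n+m k 2)) (≤-trans (≤-reflexive eq) (height≤n A))) ⟩
    k′ * ((2 + k + j) ! * (n ∸ (2 + k + j)) !)
      ≡⟨ cong (λ h → k′ * (h ! * (n ∸ h) !)) eq ⟩
    k′ * (height A ! * (n ∸ height A) !)
      ≡⟨ cong (k′ *_) (through≡height A) ⟨
    k′ * through A ∎
    where
    open ≤-Reasoning
    k′≡ : k′ ≡ suc (n ∸ (2 + k))
    k′≡ = trans (sym (m+n∸n≡m k′ k)) (+-∸-assoc 1 {n} {2 + k} 2+k≤n)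
    k′!≡ : k′ ! ≡ k′ * (n ∸ (2 + k)) !
    k′!≡ = trans (cong _! k′≡) (cong (_* (n ∸ (2 + k)) !) (sym k′≡))
    lemma : ∀ a b x y z → a * (b * (x * (y * z))) ≡ y * (a * (b * x) * z)
    lemma = solve-∀

  far-heavy : ∀ (A : Subset n) R → 2 + k ≤ height A → height A < n → length R ≤ 3 →
    All (A ≢_) R → All (λ B → height B ≤ height A) R → Heavy R → Heavy (A ∷ R)
  far-heavy A R far hA<n len A∉R hR heavy = begin
    t + length R * t
      ≤⟨ +-mono-≤ t≤ heavy ⟩
    2 * (k * w) + 2 * meeting R
      ≡⟨ trans (+-comm _ (2 * meeting R)) (sym (*-distribˡ-+ 2 (meeting R) (k * w))) ⟩
    2 * (meeting R + k * w)
      ≤⟨ *-monoʳ-≤ 2 gained ⟩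
    2 * meeting (A ∷ R) ∎
    where
    open ≤-Reasoning
    S = sum (map (through₂ A) R)
    -- Hence k! k! new chains pay for the share of A.
    t≤ : t ≤ 2 * (k * w)
    t≤ = ≤-trans (*-monoˡ-≤ w (+-monoˡ-≤ k (n≤1+n k′))) (≤-reflexive (lemma k w))
      where
      lemma : ∀ k w → (k + k) * w ≡ 2 * (k * w)
      lemma = solve-∀
    S≤ : (2 + k) * S ≤ 3 * through A
    S≤ = ≤-trans (sum-through₂≤ (2 + k) A R (All.zipWith
           (λ {B} (A≢B , hB) → ≤-trans (*-monoˡ-≤ (through₂ A B) {2 + k} {height A} far) (charge A B A≢B hB hA<n)) (A∉R , hR)))
         (*-monoˡ-≤ (through A) len)
    gained : meeting R + k * w ≤ meeting (A ∷ R)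
    -- With the denominator k + 2 cleared, the gain `k * w` and the at most three charges fit
    -- together into `through A`.
    gained = +-cancelʳ-≤ S _ _ (*-cancelˡ-≤ (2 + k) (begin
      (2 + k) * (meeting R + k * w + S)
        ≡⟨ lemma₁ (2 + k) (meeting R) (k * w) S ⟩
      (2 + k) * meeting R + ((2 + k) * (k * w) + (2 + k) * S)
        ≤⟨ +-monoʳ-≤ ((2 + k) * meeting R) (+-mono-≤ (far-through A far) S≤) ⟩
      (2 + k) * meeting R + (k′ * through A + 3 * through A)
        ≡⟨ lemma₂ k′ (meeting R) (through A) ⟩
      (2 + k) * (meeting R + through A)
        ≤⟨ *-monoʳ-≤ (2 + k) (gain A R R λ _ _ m → m) ⟩
      (2 + k) * (meeting (A ∷ R) + S) ∎))
      where
      lemma₁ : ∀ a x y z → a * (x + y + z) ≡ a * x + (a * y + a * z)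
      lemma₁ = solve-∀
      lemma₂ : ∀ k′ x y → (3 + k′) * x + (k′ * y + 3 * y) ≡ (3 + k′) * (x + y)
      lemma₂ = solve-∀

  -- Sets at the levels k - 1, k and k + 1.

  -- For P with q sets at levels k ± 1 and j sets at level k: e comparable pairs
  -- are charged one unit each.
  record Near (P : List (Subset n)) (e q j : ℕ) : Set where
    constructor near
    field
      bound : (j * k + q * suc k) * w ≤ meeting P + e * w

  open Near

  -- As t = (2k - 1) `w`, twice the k units of a middle set exceed its share by one unit, and twice
  -- the k + 1 units of an off-middle set by three. Each charge costs two of these surplus units.
  near-heavy : ∀ {P e q j} → Near P e q j → 2 * e ≤ 3 * q + j → length P ≡ q + j → Heavy P
  near-heavy {P} {e} {q} {j} near-P e≤ len = +-cancelʳ-≤ ((3 * q + j) * w) _ _ (begin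
    length P * t + (3 * q + j) * w  ≡⟨ cong (λ x → x * t + (3 * q + j) * w) len ⟩
    (q + j) * t + (3 * q + j) * w   ≡⟨ lemma₁ q j k′ w ⟩
    2 * ((j * k + q * suc k) * w)   ≤⟨ *-monoʳ-≤ 2 (bound near-P) ⟩
    2 * (meeting P + e * w)         ≡⟨ lemma₂ (meeting P) e w ⟩
    2 * meeting P + 2 * e * w       ≤⟨ +-monoʳ-≤ (2 * meeting P) (*-monoˡ-≤ w e≤) ⟩
    2 * meeting P + (3 * q + j) * w ∎)
    where
    open ≤-Reasoning
    lemma₁ : ∀ q j k′ w → (q + j) * ((k′ + suc k′) * w) + (3 * q + j) * w ≡ 2 * ((j * suc k′ + q * suc (suc k′)) * w)
    lemma₁ = solve-∀
    lemma₂ : ∀ x e w → 2 * (x + e * w) ≡ 2 * x + 2 * e * w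
    lemma₂ = solve-∀

  near-mids : ∀ M → Unique M → All (λ A → height A ≡ k) M → Near M 0 0 (length M)
  near-mids [] _ _ = near z≤n
  near-mids (A ∷ M) (A∉M ∷ uM) (hA ∷ hM) = near (begin
    ((k + length M * k) + 0) * w
      ≡⟨ lemma k (length M) w ⟩
    (length M * k + 0) * w + k * w
      ≤⟨ +-mono-≤ (bound (near-mids M uM hM)) (≤-reflexive (sym (through-mid A hA))) ⟩
    meeting M + 0 + through A
      ≡⟨ cong (_+ through A) (+-identityʳ (meeting M)) ⟩
    meeting M + through A
      ≤⟨ gain A M [] (meets-drop {A = A} M [] (All.zipWith (λ {B} (A≢B , hB) → inj₂ (equal-size⇒Disjoint A≢B (trans (mid-size A hA) (sym (mid-size B hB))))) (A∉M , hM))) ⟩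
    meeting (A ∷ M) + 0 ∎)
    where
    open ≤-Reasoning
    lemma : ∀ k l w → ((k + l * k) + 0) * w ≡ (l * k + 0) * w + k * w
    lemma = solve-∀

  -- A lies on k + 1 units of chains, and by `charge` each member of Q takes at most the fraction
  -- 1/(k + 1) of them, that is, one unit.
  near-off : ∀ {A R e q j} Q → height A ≡ suc k → suc k < n →
    All (A ≢_) Q → All (λ B → height B ≤ suc k) Q →
    (∀ ω → T (hits A ω) → T (meets R ω) → T (meets Q ω)) →
    Near R e q j → Near (A ∷ R) (length Q + e) (suc q) j
  near-off {A} {R} {e} {q} {j} Q hA k<n A∉Q hQ drop near-R = near (begin
    (j * k + suc q * suc k) * w
      ≡⟨ lemma₁ k j q w ⟩
    (j * k + q * suc k) * w + suc k * w
      ≤⟨ +-mono-≤ (bound near-R) (≤-reflexive (sym (through-off A hA))) ⟩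
    meeting R + e * w + through A
      ≡⟨ lemma₂ (meeting R) (e * w) (through A) ⟩
    meeting R + through A + e * w
      ≤⟨ +-monoˡ-≤ (e * w) (gain A R Q drop) ⟩
    meeting (A ∷ R) + sum (map (through₂ A) Q) + e * w
      ≤⟨ +-monoˡ-≤ (e * w) (+-monoʳ-≤ (meeting (A ∷ R)) S≤) ⟩
    meeting (A ∷ R) + length Q * w + e * w
      ≡⟨ lemma₃ (meeting (A ∷ R)) (length Q) e w ⟩
    meeting (A ∷ R) + (length Q + e) * w ∎)
    where
    open ≤-Reasoning
    pair≤ : ∀ {B} → A ≢ B × height B ≤ suc k → 1 * through₂ A B ≤ w
    pair≤ {B} (A≢B , hB) = *-cancelˡ-≤ (suc k) (begin
      suc k * (1 * through₂ A B)
        ≡⟨ cong₂ _*_ (sym hA) (*-identityˡ (through₂ A B)) ⟩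
      height A * through₂ A B
        ≤⟨ charge A B A≢B (≤-trans hB (≤-reflexive (sym hA))) (subst (_< n) (sym hA) k<n) ⟩
      through A
        ≡⟨ through-off A hA ⟩
      suc k * w ∎)
    S≤ : sum (map (through₂ A) Q) ≤ length Q * w
    S≤ = ≤-trans (≤-reflexive (sym (*-identityˡ _))) (sum-through₂≤ 1 A Q (All.zipWith pair≤ (A∉Q , hQ)))
    lemma₁ : ∀ k j q w → (j * k + suc q * suc k) * w ≡ (j * k + q * suc k) * w + suc k * w
    lemma₁ = solve-∀
    lemma₂ : ∀ x y z → x + y + z ≡ x + z + y
    lemma₂ = solve-∀
    lemma₃ : ∀ x l e w → x + l * w + e * w ≡ x + (l + e) * w
    lemma₃ = solve-∀

  -- Reasons why at most four of the pairs AB, AM, AM′, BM, BM′ need to be charged.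
  data Slack (A B M M′ : Subset n) : Set where
    AB  : Disjoint A B  → Slack A B M M′
    AM  : Disjoint A M  → Slack A B M M′
    AM′ : Disjoint A M′ → Slack A B M M′
    BM  : Disjoint B M  → Slack A B M M′
    BM′ : Disjoint B M′ → Slack A B M M′
    between-MM′ : (∀ ω → T (hits A ω) → T (hits B ω) → T (hits M ω) ⊎ T (hits M′ ω)) → Slack A B M M′

  Slack-sym : ∀ {A B M M′} → Slack A B M M′ → Slack B A M M′
  Slack-sym (AB d)  = AB (Disjoint-sym d)
  Slack-sym (AM d)  = BM d
  Slack-sym (AM′ d) = BM′ d
  Slack-sym (BM d)  = AM d
  Slack-sym (BM′ d) = AM′ d
  Slack-sym (between-MM′ f) = between-MM′ λ ω p q → f ω q p

  -- Either one of the inclusions A ⊆ M, A ⊆ M′, M ⊆ B, M′ ⊆ B fails, and that pair shares no chain,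
  -- or the four sets form a diamond and `between` applies.
  low-high-slack : ∀ {A B M M′} → ∣ A ∣ ≡ k′ → ∣ B ∣ ≡ suc k → ∣ M ∣ ≡ k → ∣ M′ ∣ ≡ k → M ≢ M′ → Slack A B M M′
  low-high-slack {A} {B} {M} {M′} a b m m′ M≢M′ with A ⊆? M
  ... | no A⊈M = AM (⊈⇒Disjoint A⊈M (≤-trans (≤-reflexive a) (≤-trans (n≤1+n k′) (≤-reflexive (sym m)))))
  ... | yes A⊆M with A ⊆? M′ | M ⊆? B | M′ ⊆? B
  ...   | no A⊈M′ | _ | _ = AM′ (⊈⇒Disjoint A⊈M′ (≤-trans (≤-reflexive a) (≤-trans (n≤1+n k′) (≤-reflexive (sym m′)))))
  ...   | _ | no M⊈B | _ = BM (Disjoint-sym (⊈⇒Disjoint M⊈B (≤-trans (≤-reflexive m) (≤-trans (n≤1+n k) (≤-reflexive (sym b))))))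
  ...   | _ | _ | no M′⊈B = BM′ (Disjoint-sym (⊈⇒Disjoint M′⊈B (≤-trans (≤-reflexive m′) (≤-trans (n≤1+n k) (≤-reflexive (sym b))))))
  ...   | yes A⊆M′ | yes M⊆B | yes M′⊆B = between-MM′ λ ω → between A M M′ B ω A⊆M A⊆M′ M⊆B M′⊆B M≢M′
    (trans m (cong suc (sym a))) (trans m′ (cong suc (sym a))) (trans b (cong (suc ∘ suc) (sym a)))

  slack : ∀ A B M M′ → height A ≡ suc k → height B ≡ suc k → height M ≡ k → height M′ ≡ k →
    A ≢ B → M ≢ M′ → Slack A B M M′
  slack A B M M′ hA hB hM hM′ A≢B M≢M′ with off-size A hA | off-size B hB
  ... | inj₁ a | inj₁ b = AB (equal-size⇒Disjoint A≢B (trans a (sym b)))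
  ... | inj₂ a | inj₂ b = AB (equal-size⇒Disjoint A≢B (trans a (sym b)))
  ... | inj₁ a | inj₂ b = low-high-slack a b (mid-size M hM) (mid-size M′ hM′) M≢M′
  ... | inj₂ a | inj₁ b = Slack-sym (low-high-slack b a (mid-size M hM) (mid-size M′ hM′) M≢M′)

  -- The budget 2e ≤ 3q + j allows four charges. M and M′ share no chain, and `slack` saves one of
  -- the other five pairs.
  two-two : ∀ {A B M M′} → height A ≡ suc k → height B ≡ suc k → height M ≡ k → height M′ ≡ k → suc k < n →
    Unique (A ∷ B ∷ M ∷ M′ ∷ []) → Near (A ∷ B ∷ M ∷ M′ ∷ []) 4 2 2
  two-two {A} {B} {M} {M′} hA hB hM hM′ k<n ((A≢B ∷ A≢M ∷ A≢M′ ∷ []) ∷ (B≢M ∷ B≢M′ ∷ []) ∷ uM) =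
    cases (slack A B M M′ hA hB hM hM′ A≢B (All.head (AllPairs.head uM)))
    where
    B≤ : height B ≤ suc k
    B≤ = ≤-reflexive hB
    M≤ : height M ≤ suc k
    M≤ = ≤-trans (≤-reflexive hM) (n≤1+n k)
    M′≤ : height M′ ≤ suc k
    M′≤ = ≤-trans (≤-reflexive hM′) (n≤1+n k)
    mids = near-mids (M ∷ M′ ∷ []) uM (hM ∷ hM′ ∷ [])
    tail : ∀ {Q} → All (B ≢_) Q → All (λ C → height C ≤ suc k) Q → All (λ C → C ∈ Q ⊎ Disjoint B C) (M ∷ M′ ∷ []) →
      Near (B ∷ M ∷ M′ ∷ []) (length Q + 0) 1 2
    tail {Q} B∉Q hQ ds = near-off {R = M ∷ M′ ∷ []} Q hB k<n B∉Q hQ (meets-drop (M ∷ M′ ∷ []) Q ds) mids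
    both = tail (B≢M ∷ B≢M′ ∷ []) (M≤ ∷ M′≤ ∷ []) (inj₁ (here refl) ∷ inj₁ (there (here refl)) ∷ [])
    full : ∀ {e} → Near (B ∷ M ∷ M′ ∷ []) e 1 2 → Near (A ∷ B ∷ M ∷ M′ ∷ []) (3 + e) 2 2
    full = near-off {R = B ∷ M ∷ M′ ∷ []} (B ∷ M ∷ M′ ∷ []) hA k<n (A≢B ∷ A≢M ∷ A≢M′ ∷ []) (B≤ ∷ M≤ ∷ M′≤ ∷ []) λ _ _ m → m
    cases : Slack A B M M′ → Near (A ∷ B ∷ M ∷ M′ ∷ []) 4 2 2
    cases (AB d) = near-off {R = B ∷ M ∷ M′ ∷ []} (M ∷ M′ ∷ []) hA k<n (A≢M ∷ A≢M′ ∷ []) (M≤ ∷ M′≤ ∷ [])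
      (meets-drop (B ∷ M ∷ M′ ∷ []) (M ∷ M′ ∷ []) (inj₂ d ∷ inj₁ (here refl) ∷ inj₁ (there (here refl)) ∷ [])) both
    cases (AM d) = near-off {R = B ∷ M ∷ M′ ∷ []} (B ∷ M′ ∷ []) hA k<n (A≢B ∷ A≢M′ ∷ []) (B≤ ∷ M′≤ ∷ [])
      (meets-drop (B ∷ M ∷ M′ ∷ []) (B ∷ M′ ∷ []) (inj₁ (here refl) ∷ inj₂ d ∷ inj₁ (there (here refl)) ∷ [])) both
    cases (AM′ d) = near-off {R = B ∷ M ∷ M′ ∷ []} (B ∷ M ∷ []) hA k<n (A≢B ∷ A≢M ∷ []) (B≤ ∷ M≤ ∷ [])
      (meets-drop (B ∷ M ∷ M′ ∷ []) (B ∷ M ∷ []) (inj₁ (here refl) ∷ inj₁ (there (here refl)) ∷ inj₂ d ∷ [])) both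
    cases (BM d) = full (tail (B≢M′ ∷ []) (M′≤ ∷ []) (inj₂ d ∷ inj₁ (here refl) ∷ []))
    cases (BM′ d) = full (tail (B≢M ∷ []) (M≤ ∷ []) (inj₁ (here refl) ∷ inj₂ d ∷ []))
    -- B is not charged to A even though they may be comparable: a chain through both passes M or M′
    -- and is charged there.
    cases (between-MM′ f) = near-off {R = B ∷ M ∷ M′ ∷ []} (M ∷ M′ ∷ []) hA k<n (A≢M ∷ A≢M′ ∷ []) (M≤ ∷ M′≤ ∷ []) drop both
      where
      drop : ∀ ω → T (hits A ω) → T (meets (B ∷ M ∷ M′ ∷ []) ω) → T (meets (M ∷ M′ ∷ []) ω)
      drop ω p m with hits B ω in eq
      ... | false = m
      ... | true with f ω p (Equivalence.from T-≡ eq)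
      ...   | inj₁ q = meets⁺ {P = M ∷ M′ ∷ []} ω (here refl) q
      ...   | inj₂ q = meets⁺ {P = M ∷ M′ ∷ []} ω (there (here refl)) q

  -- The budget allows five of the six pairs. Of three sets on the two levels k - 1 and k + 1, two
  -- are on the same level and share no chain.
  three-one : ∀ {A B D M} → height A ≡ suc k → height B ≡ suc k → height D ≡ suc k → height M ≡ k → suc k < n →
    Unique (A ∷ B ∷ D ∷ M ∷ []) → Near (A ∷ B ∷ D ∷ M ∷ []) 5 3 1
  three-one {A} {B} {D} {M} hA hB hD hM k<n ((A≢B ∷ A≢D ∷ A≢M ∷ []) ∷ (B≢D ∷ B≢M ∷ []) ∷ (D≢M ∷ []) ∷ uM) =
    cases (off-size A hA) (off-size B hB) (off-size D hD)
    where
    B≤ : height B ≤ suc k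
    B≤ = ≤-reflexive hB
    D≤ : height D ≤ suc k
    D≤ = ≤-reflexive hD
    M≤ : height M ≤ suc k
    M≤ = ≤-trans (≤-reflexive hM) (n≤1+n k)
    one : Near (D ∷ M ∷ []) 1 1 1
    one = near-off {R = M ∷ []} (M ∷ []) hD k<n (D≢M ∷ []) (M≤ ∷ []) (λ _ _ m → m) (near-mids (M ∷ []) uM (hM ∷ []))
    two : Near (B ∷ D ∷ M ∷ []) 3 2 1
    two = near-off {R = D ∷ M ∷ []} (D ∷ M ∷ []) hB k<n (B≢D ∷ B≢M ∷ []) (D≤ ∷ M≤ ∷ []) (λ _ _ m → m) one
    AB-case : Disjoint A B → Near (A ∷ B ∷ D ∷ M ∷ []) 5 3 1
    AB-case d = near-off {R = B ∷ D ∷ M ∷ []} (D ∷ M ∷ []) hA k<n (A≢D ∷ A≢M ∷ []) (D≤ ∷ M≤ ∷ [])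
      (meets-drop (B ∷ D ∷ M ∷ []) (D ∷ M ∷ []) (inj₂ d ∷ inj₁ (here refl) ∷ inj₁ (there (here refl)) ∷ [])) two
    AD-case : Disjoint A D → Near (A ∷ B ∷ D ∷ M ∷ []) 5 3 1
    AD-case d = near-off {R = B ∷ D ∷ M ∷ []} (B ∷ M ∷ []) hA k<n (A≢B ∷ A≢M ∷ []) (B≤ ∷ M≤ ∷ [])
      (meets-drop (B ∷ D ∷ M ∷ []) (B ∷ M ∷ []) (inj₁ (here refl) ∷ inj₂ d ∷ inj₁ (there (here refl)) ∷ [])) two
    BD-case : Disjoint B D → Near (A ∷ B ∷ D ∷ M ∷ []) 5 3 1
    BD-case d = near-off {R = B ∷ D ∷ M ∷ []} (B ∷ D ∷ M ∷ []) hA k<n (A≢B ∷ A≢D ∷ A≢M ∷ []) (B≤ ∷ D≤ ∷ M≤ ∷ []) (λ _ _ m → m)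
      (near-off {R = D ∷ M ∷ []} (M ∷ []) hB k<n (B≢M ∷ []) (M≤ ∷ [])
        (meets-drop (D ∷ M ∷ []) (M ∷ []) (inj₂ d ∷ inj₁ (here refl) ∷ [])) one)
    cases : ∣ A ∣ ≡ k′ ⊎ ∣ A ∣ ≡ suc k → ∣ B ∣ ≡ k′ ⊎ ∣ B ∣ ≡ suc k → ∣ D ∣ ≡ k′ ⊎ ∣ D ∣ ≡ suc k →
      Near (A ∷ B ∷ D ∷ M ∷ []) 5 3 1
    cases (inj₁ a) (inj₁ b) _        = AB-case (equal-size⇒Disjoint A≢B (trans a (sym b)))
    cases (inj₂ a) (inj₂ b) _        = AB-case (equal-size⇒Disjoint A≢B (trans a (sym b)))
    cases (inj₁ a) _        (inj₁ d) = AD-case (equal-size⇒Disjoint A≢D (trans a (sym d)))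
    cases (inj₂ a) _        (inj₂ d) = AD-case (equal-size⇒Disjoint A≢D (trans a (sym d)))
    cases _        (inj₁ b) (inj₁ d) = BD-case (equal-size⇒Disjoint B≢D (trans b (sym d)))
    cases _        (inj₂ b) (inj₂ d) = BD-case (equal-size⇒Disjoint B≢D (trans b (sym d)))

  -- Equal to q j + q (q - 1)/2, the number of pairs with a member off the middle level.
  pairs : ℕ → ℕ → ℕ
  pairs zero    j = 0
  pairs (suc q) j = q + j + pairs q j

  near-crude : ∀ O M → Unique (O ++ M) → All (λ A → height A ≡ suc k) O → All (λ A → height A ≡ k) M → suc k < n →
    Near (O ++ M) (pairs (length O) (length M)) (length O) (length M)
  near-crude [] M u [] hM k<n = near-mids M u hM
  near-crude (A ∷ O) M (A∉ ∷ u) (hA ∷ hO) hM k<n =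
    subst (λ l → Near (A ∷ O ++ M) (l + pairs (length O) (length M)) (suc (length O)) (length M)) (length-++ O)
      (near-off {R = O ++ M} (O ++ M) hA k<n A∉
        (All-++⁺ (All.map ≤-reflexive hO) (All.map (λ e → ≤-trans (≤-reflexive e) (n≤1+n k)) hM))
        (λ _ _ m → m) (near-crude O M u hO hM k<n))

  split-heavy : ∀ O M → Unique (O ++ M) → All (λ A → height A ≡ suc k) O → All (λ A → height A ≡ k) M →
    suc k < n → length O + length M ≤ 4 → Heavy (O ++ M)
  split-heavy O M u hO hM k<n len = by-shape O M u hO hM len
      (λ ok → near-heavy {O ++ M} {pairs (length O) (length M)} {length O} {length M} (near-crude O M u hO hM k<n) ok (length-++ O))
    where
    by-shape : ∀ O M → Unique (O ++ M) → All (λ A → height A ≡ suc k) O → All (λ A → height A ≡ k) M →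
      length O + length M ≤ 4 →
      (2 * pairs (length O) (length M) ≤ 3 * length O + length M → Heavy (O ++ M)) → Heavy (O ++ M)
    by-shape [] M _ _ _ _ crude = crude z≤n
    by-shape (_ ∷ []) M _ _ _ (s≤s len) crude = crude (begin
      2 * (length M + 0)  ≡⟨ lemma (length M) ⟩
      length M + length M ≤⟨ +-monoˡ-≤ (length M) len ⟩
      3 + length M        ∎)
      where
      open ≤-Reasoning
      lemma : ∀ m → 2 * (m + 0) ≡ m + m
      lemma = solve-∀
    -- The literals here and below are twice `pairs q j` and 3q + j; for four sets off the middle
    -- both are 12.
    by-shape (_ ∷ _ ∷ []) [] _ _ _ _ crude = crude (≤ᵇ⇒≤ 2 6 _)
    by-shape (_ ∷ _ ∷ []) (_ ∷ []) _ _ _ _ crude = crude (≤ᵇ⇒≤ 6 7 _)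
    by-shape (A ∷ B ∷ []) (M ∷ M′ ∷ []) u (hA ∷ hB ∷ []) (hM ∷ hM′ ∷ []) _ _ =
      near-heavy {e = 4} {2} {2} (two-two hA hB hM hM′ k<n u) ≤-refl refl
    by-shape (_ ∷ _ ∷ _ ∷ []) [] _ _ _ _ crude = crude (≤ᵇ⇒≤ 6 9 _)
    by-shape (A ∷ B ∷ D ∷ []) (M ∷ []) u (hA ∷ hB ∷ hD ∷ []) (hM ∷ []) _ _ =
      near-heavy {e = 5} {3} {1} (three-one hA hB hD hM k<n u) ≤-refl refl
    by-shape (_ ∷ _ ∷ _ ∷ _ ∷ []) [] _ _ _ _ crude = crude ≤-refl
    by-shape (_ ∷ _ ∷ []) (_ ∷ _ ∷ _ ∷ _) _ _ _ (s≤s (s≤s (s≤s (s≤s ()))))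
    by-shape (_ ∷ _ ∷ _ ∷ []) (_ ∷ _ ∷ _) _ _ _ (s≤s (s≤s (s≤s (s≤s ()))))
    by-shape (_ ∷ _ ∷ _ ∷ _ ∷ []) (_ ∷ _) _ _ _ (s≤s (s≤s (s≤s (s≤s ()))))
    by-shape (_ ∷ _ ∷ _ ∷ _ ∷ _ ∷ _) _ _ _ _ (s≤s (s≤s (s≤s (s≤s ()))))

  -- All families of at most four sets.

  Descending : List (Subset n) → Set
  Descending = AllPairs λ A B → height B ≤ height A

  split : ∀ P → Descending P → All (λ A → height A ≤ suc k) P →
    ∃₂ λ O M → P ≡ O ++ M × All (λ A → height A ≡ suc k) O × All (λ A → height A ≡ k) M
  split [] _ _ = [] , [] , refl , [] , []
  split (A ∷ P) (A≥ ∷ desc) (hA ∷ hP) with m≤n⇒m<n∨m≡n hA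
  -- Heights are at least k, so once one is below k + 1, it and all later ones equal k.
  ... | inj₁ lt = [] , A ∷ P , refl , [] ,
    ≤-antisym (≤-pred lt) (k≤height A) ∷ All.map (λ {B} le → ≤-antisym (≤-trans le (≤-pred lt)) (k≤height B)) A≥
  ... | inj₂ eq with O , M , refl , hO , hM ← split P desc hP = A ∷ O , M , refl , eq ∷ hO , hM

  -- The order puts a farthest set first, as `charge` requires. Only a set at height k + 2 or more
  -- is removed by recursion; otherwise the whole list is counted in units at once.
  descending-heavy : ∀ P → length P ≤ 4 → Unique P → Descending P → Heavy P
  descending-heavy [] _ _ _ = z≤n
  descending-heavy (A ∷ R) (s≤s len) (A∉R ∷ u) (A≥ ∷ desc) with m≤n⇒m<n∨m≡n (height≤n A)
  ... | inj₂ full = full-heavy A R full len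
  ... | inj₁ hA<n with ≤-<-connex (height A) (suc k)
  ...   | inj₂ far = far-heavy A R far hA<n len A∉R A≥ (descending-heavy R (m≤n⇒m≤1+n len) u desc)
  ...   | inj₁ hA≤ with split (A ∷ R) (A≥ ∷ desc) (hA≤ ∷ All.map (λ le → ≤-trans le hA≤) A≥)
  ...     | [] , M , refl , [] , hM =
    near-heavy {M} {0} {0} {length M} (near-mids M (A∉R ∷ u) hM) z≤n refl
  ...     | O@(_ ∷ _) , M , refl , hO@(hA ∷ _) , hM =
    split-heavy O M (A∉R ∷ u) hO hM (subst (_< n) hA hA<n) (subst (_≤ 4) (length-++ O) (s≤s len))

-- Sorting, and components of the comparability graph.

hits-comparable : ∀ {n} (A B : Subset n) ω → T (hits A ω) → T (hits B ω) → A ⊆ B ⊎ B ⊆ A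
hits-comparable A B ω p q with ≤-total (∣ A ∣) (∣ B ∣)
... | inj₁ le = inj₁ (hits-⊆ A B ω p q le)
... | inj₂ ge = inj₂ (hits-⊆ B A ω q p ge)

insert-descending : ∀ {A : Set} (f : A → ℕ) x ys → AllPairs (λ a b → f b ≤ f a) ys →
  ∃ λ zs → zs ↭ x ∷ ys × AllPairs (λ a b → f b ≤ f a) zs
insert-descending f x [] [] = x ∷ [] , ↭-refl , [] ∷ []
insert-descending f x (y ∷ ys) (y≥ ∷ desc) with ≤-total (f y) (f x)
... | inj₁ fy≤fx = x ∷ y ∷ ys , ↭-refl , (fy≤fx ∷ All.map (λ le → ≤-trans le fy≤fx) y≥) ∷ y≥ ∷ desc
... | inj₂ fx≤fy with zs , zs↭ , desc′ ← insert-descending f x ys desc =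
  y ∷ zs , ↭-trans (prep y zs↭) (swap y x ↭-refl) , All-resp-↭ (↭-sym zs↭) (fx≤fy ∷ y≥) ∷ desc′

sort-descending : ∀ {A : Set} (f : A → ℕ) xs → ∃ λ zs → zs ↭ xs × AllPairs (λ a b → f b ≤ f a) zs
sort-descending f [] = [] , ↭-refl , []
sort-descending f (x ∷ xs) with ys , ys↭ , desc ← sort-descending f xs
  with zs , zs↭ , desc′ ← insert-descending f x ys desc = zs , ↭-trans zs↭ (prep x ys↭) , desc′

Unique-resp-↭ : ∀ {A : Set} {xs ys : List A} → xs ↭ ys → Unique xs → Unique ys
Unique-resp-↭ {A} p = Setoid↭.Unique-resp-↭ (setoid A) (↭⇒↭ₛ p)

Adj? : ∀ {n} (A B : Subset n) → Dec (Adj A B)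
Adj? A B = ¬? (≡-dec Bool._≟_ A B) ×-dec (A ⊆? B ⊎-dec B ⊆? A)

Connected-snoc : ∀ {n} {F : List (Subset n)} {A B D} → Connected F A B → Adj B D → D ∈ F → Connected F A D
Connected-snoc (here B∈F)      adj D∈F = step B∈F adj (here D∈F)
Connected-snoc (step A∈F a p) adj D∈F = step A∈F a (Connected-snoc p adj D∈F)

Connected-mono : ∀ {n} {F G : List (Subset n)} → (∀ {A} → A ∈ F → A ∈ G) →
  ∀ {A B} → Connected F A B → Connected G A B
Connected-mono F⊆G (here A∈F)     = here (F⊆G A∈F)
Connected-mono F⊆G (step A∈F a p) = step (F⊆G A∈F) a (Connected-mono F⊆G p)

ComponentsAtMost-mono : ∀ {n k} {F G : List (Subset n)} → (∀ {A} → A ∈ F → A ∈ G) →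
  ComponentsAtMost k G → ComponentsAtMost k F
ComponentsAtMost-mono F⊆G small A A∈F L uL conn = small A (F⊆G A∈F) L uL (All.map (Connected-mono F⊆G) conn)

Separated : ∀ {n} → List (Subset n) → List (Subset n) → Set
Separated P R = ∀ {A B} → A ∈ P → B ∈ R → ¬ Adj A B

extract : ∀ {A : Set} {x : A} {xs} → x ∈ xs → ∃ λ ys → xs ↭ x ∷ ys
extract x∈xs with ys , zs , refl ← ∈-∃++ x∈xs = ys ++ zs , shift _ ys zs

-- Absorbs into P, one at a time, members of R adjacent to P until none is left.
saturate : ∀ {n} {F : List (Subset n)} {A} fuel P R → length R ≤ fuel → P ++ R ↭ F → All (Connected F A) P →
  ∃₂ λ P′ R′ → P′ ++ R′ ↭ F × length R′ ≤ length R × All (Connected F A) P′ × Separated P′ R′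
saturate fuel P [] _ P↭F conn = P , [] , P↭F , z≤n , conn , λ _ ()
saturate {F = F} (suc fuel) P R@(_ ∷ _) len P++R↭F conn with Any.any? (λ B → Any.any? (λ A → Adj? A B) P) R
... | no ¬adj = P , R , P++R↭F , ≤-refl , conn , λ A∈P B∈R adj → ¬adj (lose B∈R (lose A∈P adj))
... | yes adj with B , B∈R , adjB ← find adj
  with D , D∈P , D~B ← find adjB | R₁ , R↭ ← extract B∈R
  with moved ← ↭-trans (↭-sym (↭-trans (++⁺ˡ P R↭) (shift B P R₁))) P++R↭F
  with P′ , R′ , ↭F , len′ , conn′ , sep ← saturate fuel (B ∷ P) R₁
         (≤-pred (≤-trans (≤-reflexive (sym (↭-length R↭))) len)) moved
         (Connected-snoc (All.lookup conn D∈P) D~B (∈-resp-↭ moved (here refl)) ∷ conn)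
  = P′ , R′ , ↭F , ≤-trans len′ (≤-trans (n≤1+n _) (≤-reflexive (sym (↭-length R↭)))) , conn′ , sep

Unique-++⁻-≢ : ∀ {A : Set} {x y : A} xs {ys} → Unique (xs ++ ys) → x ∈ xs → y ∈ ys → x ≢ y
Unique-++⁻-≢ (x ∷ xs) (x∉ ∷ u) (here refl) y∈ys = All.lookup x∉ (∈-++⁺ʳ xs y∈ys)
Unique-++⁻-≢ (x ∷ xs) (x∉ ∷ u) (there x∈xs) y∈ys = Unique-++⁻-≢ xs u x∈xs y∈ys

Unique-++⁻ : ∀ {A : Set} xs {ys : List A} → Unique (xs ++ ys) → Unique xs × Unique ys
Unique-++⁻ [] u = [] , u
Unique-++⁻ (x ∷ xs) (x∉ ∷ u) with uxs , uys ← Unique-++⁻ xs u = All-++⁻ˡ xs x∉ ∷ uxs , uys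

-- From components to the whole family.

small-heavy : ∀ k′ P → length P ≤ 4 → Unique P → Heavy k′ P
small-heavy k′ P len u with Q , Q↭P , desc ← sort-descending height P =
  ≤-trans (≤-reflexive (cong (_* _) (sym (↭-length Q↭P))))
    (≤-trans (descending-heavy k′ Q (≤-trans (≤-reflexive (↭-length Q↭P)) len) (Unique-resp-↭ (↭-sym Q↭P) u) desc)
      (*-monoʳ-≤ 2 (meeting-mono {P = Q} {P} (∈-resp-↭ Q↭P))))

-- Saturation from the first set yields P, which has at most four members because all are connected
-- to A. Two sets on one chain are comparable, so P and the separated rest meet disjoint sets of
-- chains and their shares add up.
family-heavy : ∀ k′ fuel F → length F ≤ fuel → Unique F → ComponentsAtMost 4 F → Heavy k′ F
family-heavy k′ fuel [] _ _ _ = z≤n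
family-heavy k′ (suc fuel) F@(A ∷ R) (s≤s len) u small
  with P , R′ , ↭F , len′ , conn , sep ← saturate {F = F} {A} (length R) (A ∷ []) R ≤-refl ↭-refl (here (here refl) ∷ [])
  with uP , uR′ ← Unique-++⁻ P (Unique-resp-↭ (↭-sym ↭F) u) = begin
    length F * t
      ≡⟨ cong (_* t) (trans (sym (↭-length ↭F)) (length-++ P)) ⟩
    (length P + length R′) * t
      ≡⟨ *-distribʳ-+ t (length P) (length R′) ⟩
    length P * t + length R′ * t
      ≤⟨ +-mono-≤ (small-heavy k′ P (small A (here refl) P uP conn) uP) (family-heavy k′ fuel R′ (≤-trans len′ len) uR′ (ComponentsAtMost-mono R′⊆F small)) ⟩
    2 * meeting P + 2 * meeting R′
      ≡⟨ *-distribˡ-+ 2 (meeting P) (meeting R′) ⟨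
    2 * (meeting P + meeting R′)
      ≤⟨ *-monoʳ-≤ 2 (meeting-disjoint P R′ F P⊆F R′⊆F apart-hits) ⟩
    2 * meeting F ∎
  where
  open ≤-Reasoning
  t = (k′ + suc k′) * (suc k′ ! * k′ !)
  P⊆F : ∀ {B} → B ∈ P → B ∈ F
  P⊆F B∈P = ∈-resp-↭ ↭F (∈-++⁺ˡ B∈P)
  R′⊆F : ∀ {B} → B ∈ R′ → B ∈ F
  R′⊆F B∈R′ = ∈-resp-↭ ↭F (∈-++⁺ʳ P B∈R′)
  apart-hits : ∀ {B D} ω → B ∈ P → D ∈ R′ → T (hits B ω) → ¬ T (hits D ω)
  apart-hits {B} {D} ω B∈P D∈R′ p q = sep B∈P D∈R′ (Unique-++⁻-≢ P (Unique-resp-↭ (↭-sym ↭F) u) B∈P D∈R′ ,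
    hits-comparable B D ω p q)

family-bound : ∀ k′ (F : List (Subset (suc k′ + suc k′))) → Unique F → ComponentsAtMost 4 F →
  length F ≤ 4 * ((k′ + k′) C k′)
family-bound k′ F u small = *-cancelʳ-≤ _ _ t {{t≢0}} (begin
  length F * t             ≤⟨ family-heavy k′ (length F) F ≤-refl u small ⟩
  2 * meeting F            ≤⟨ *-monoʳ-≤ 2 (meeting≤n! F) ⟩
  2 * (suc k′ + suc k′) !  ≡⟨ 4*C*t≡2*n! k′ ⟨
  4 * ((k′ + k′) C k′) * t ∎)
  where
  open ≤-Reasoning
  t = (k′ + suc k′) * (suc k′ ! * k′ !)
  t≢0 : NonZero t
  t≢0 = m*n≢0 (k′ + suc k′) _ {{subst NonZero (sym (+-suc k′ k′)) _}} {{suc k′ !* k′ !≢0}}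

Subset0-unique : (A B : Subset 0) → A ≡ B
Subset0-unique [] [] = refl

theorem3p4 : (n : ℕ) → 2 ∣ n → (F : List (Subset n)) → Unique F →
    ComponentsAtMost 4 F →
    length F ≤ 4 * ((n ∸ 2) C (n / 2 ∸ 1))
theorem3p4 n (divides zero refl) [] u small = z≤n
-- For n = 0, truncated subtraction makes the bound 4 * (0 C 0) = 4. All members equal A, so F
-- itself is a list of sets connected to A.
theorem3p4 n (divides zero refl) F@(A ∷ _) u small =
  small A (here refl) F u (All.tabulate λ {B} B∈F → subst (λ D → Connected F D B) (Subset0-unique B A) (here B∈F))
theorem3p4 n (divides (suc k′) eq) F u small with refl ← trans eq (trans (*-comm (suc k′) 2) (cong (suc k′ +_) (+-identityʳ (suc k′)))) =
  subst (λ x → length F ≤ 4 * x) (sym (cong₂ _C_ top bottom)) (family-bound k′ F u small)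
  where
  top : suc k′ + suc k′ ∸ 2 ≡ k′ + k′
  top = cong (_∸ 1) (+-suc k′ k′)
  bottom : (suc k′ + suc k′) / 2 ∸ 1 ≡ k′
  bottom = cong (_∸ 1) (trans (cong (_/ 2) eq) (m*n/n≡m (suc k′) 2))
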